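{- Let $(X,\triangleright)$ be a kei, and let $(S,\triangleright)$ be a subkei. Let $C\subseteq X$ span a component of the edge-coloured multigraph $G_S$ (or equivalently of the reduced simple graph $G_S^0$), and suppose that $G_S[C]$ has diameter $d$. Then $|C|\geqslant 2^d$, and further there exists some $k\in S$ such that there are at least $2^{d-1}$ edges of colour $k$ in $G_S[C]$.
   Context: A kei is a pair $(X,\triangleright)$ with $X$ a non-empty set and $\triangleright:X\times X\to X$ a binary operation such that: for each $y\in X$ the map $x\mapsto x\triangleright y$ is a bijection on $X$; $(x\triangleright y)\triangleright z=(x\triangleright z)\triangleright(y\triangleright z)$ for all $x,y,z\in X$; $x\triangleright x=x$ for all $x\in X$; and $(x\triangleright y)\triangleright y=x$ for all $x,y\in X$. For $y\in X$ write $f_y:X\to X$ for the involution $(x)f_y=x\triangleright y$ (maps act on the right). A subkei of $(X,\triangleright)$ is a kei $(S,\triangleright)$ where $S\subseteq X$ and the operation is the restriction of $\triangleright$ to $S\times S$; thus a (non-empty) subset $S\subseteq X$ forms a subkei if and only if $(z)f_y\in S$ for all $y,z\in S$. For $S\subseteq X$, $G_S$ is the loopless edge-coloured multigraph with vertex set $X$ (the whole of $X$) and colour set $S$, in which, for each $y\in S$, there is an edge of colour $y$ between $u$ and $v$ if and only if $u\neq v$ and $(u)f_y=v$ (well defined since $f_y$ is an involution). Edges of different colours between the same two vertices are different edges. The reduced graph $G_S^0$ is the simple graph on $X$ in which $uv$ is an edge if and only if there is at least one edge between $u$ and $v$ in $G_S$. $G_S[C]$ denotes the subgraph of $G_S$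 induced on $C$. Distance and diameter refer to the usual graph distance, ignoring colours and multiplicities.
   Formalization: The claim about at least 2^{d-1} edges of colour k is stated only for d ≥ 1, since for d = 0 the component is a single vertex with no edges and the claim is false; |C| ≥ 2^d is stated for all d. -}

module Defs where

open import Algebra.Core using (Op₂)
open import Algebra.Definitions using (Idempotent; _DistributesOverʳ_)
open import Algebra.Structures using (IsMagma)
open import Data.Fin.Base using (Fin)
open import Data.Nat.Base using (ℕ; zero; suc; _≤_)
open import Data.Product.Base using (Σ; ∃; ∃-syntax; _×_; _,_; proj₁; proj₂; uncurry)
open import Data.Sum.Base using (_⊎_)
open import Data.Unit.Polymorphic.Base using (⊤)
open import Function.Base using (_on_)
open import Function.Definitions using (Bijective; Injective)
open import Level using (Level; _⊔_) renaming (suc to lsuc)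
open import Relation.Binary.Core using (Rel)
open import Relation.Binary.PropositionalEquality using (_≡_; _≢_; refl; sym; trans; cong; cong₂)
open import Relation.Unary using (Pred; _∈_; _≐_)

private
  variable
    a ℓ v k e s c : Level

-- A lower bound on cardinality, with elements identified by _≈_; A may be
-- infinite.
AtLeast : ℕ → (A : Set a) → Rel A ℓ → Set (a ⊔ ℓ)
AtLeast n A _≈_ = Σ (Fin n → A) (Injective _≡_ _≈_)

-- Membership proofs need not be unique, so elements of a subset are compared
-- by SamePoint.
Elements : {X : Set a} → Pred X c → Set (a ⊔ c)
Elements = ∃

SamePoint : {X : Set a} (C : Pred X c) → Rel (Elements C) a
SamePoint C = _≡_ on proj₁

-- The equality is a parameter so that the same axioms apply to a set under
-- _≡_ and to a subset under SamePoint.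
record IsKei {A : Set a} (_≈_ : Rel A ℓ) (_▷_ : Op₂ A) : Set (a ⊔ ℓ) where
  field
    isMagma        : IsMagma _≈_ _▷_
    nonEmpty       : A
    bijective      : ∀ y → Bijective _≈_ _≈_ (λ x → x ▷ y)
    selfDistribute : _DistributesOverʳ_ _≈_ _▷_ _▷_  -- (x ▷ y) ▷ z ≈ (x ▷ z) ▷ (y ▷ z)
    idempotent     : Idempotent _≈_ _▷_
    involutive     : ∀ x y → ((x ▷ y) ▷ y) ≈ x

record Kei a : Set (lsuc a) where
  infixl 7 _▷_
  field
    Carrier : Set a
    _▷_     : Op₂ Carrier
    isKei   : IsKei _≡_ _▷_

  open IsKei isKei public

module _ (K : Kei a) where
  open Kei K

  Closed : Pred Carrier s → Set (a ⊔ s)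
  Closed S = ∀ {z y} → z ∈ S → y ∈ S → (z ▷ y) ∈ S

  restrict : (S : Pred Carrier s) → Closed S → Op₂ (Elements S)
  restrict S closed (z , z∈S) (y , y∈S) = z ▷ y , closed z∈S y∈S

  record IsSubkei (S : Pred Carrier s) : Set (a ⊔ s) where
    field
      closed          : Closed S
      isKeiRestricted : IsKei (SamePoint S) (restrict S closed)

  -- The converse is immediate, so a subset forms a subkei exactly when it is
  -- inhabited and closed.
  closed⇒isSubkei : (S : Pred Carrier s) → Elements S → Closed S → IsSubkei S
  closed⇒isSubkei S point closed = record
    { closed          = closed
    ; isKeiRestricted = record
      { isMagma        = record
        { isEquivalence = record { refl = refl ; sym = sym ; trans = trans }
        ; ∙-cong        = cong₂ _▷_
        }
      ; nonEmpty       = point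
      ; bijective      = λ { (y , y∈S) →
            proj₁ (bijective y)
          , λ { (x , x∈S) → (x ▷ y , closed x∈S y∈S)
                          , λ z≡x▷y → trans (cong (_▷ y) z≡x▷y) (involutive x y) } }
      ; selfDistribute = λ { (z , _) (x , _) (y , _) → selfDistribute z x y }
      ; idempotent     = λ { (x , _) → idempotent x }
      ; involutive     = λ { (x , _) (y , _) → involutive x y }
      }
    }

-- Between two given vertices there is at most one edge of each colour, so a
-- relation per colour suffices.  The vertices form a subset of an ambient set V, so that an induced subgraph
-- lives on the same ambient set.  Edge i x y says that there is an edge of
-- colour i between x and y.
record ColouredMultigraph (V : Set v) (Colour : Set k) c e : Set (v ⊔ k ⊔ lsuc (c ⊔ e)) where
  field
    Vertex   : Pred V c
    Edge     : Colour → Rel V e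
    isVertex : ∀ {i x y} → Edge i x y → x ∈ Vertex
    symEdge  : ∀ {i x y} → Edge i x y → Edge i y x
    loopless : ∀ {i x y} → Edge i x y → x ≢ y

module _ {V : Set v} {Colour : Set k} (G : ColouredMultigraph V Colour c e) where
  open ColouredMultigraph G

  -- Adjacency in the reduced simple graph.
  Adjacent : Rel V (k ⊔ e)
  Adjacent x y = ∃[ i ] Edge i x y

  data Walk : ℕ → Rel V (v ⊔ k ⊔ e) where
    stop : ∀ {x} → Walk zero x x
    step : ∀ {n x y z} → Adjacent x y → Walk n y z → Walk (suc n) x z

  Connected : Rel V (v ⊔ k ⊔ e)
  Connected x y = ∃[ n ] Walk n x y

  IsComponent : Pred V ℓ → Set (v ⊔ k ⊔ c ⊔ e ⊔ ℓ)
  IsComponent C = ∃[ x ] x ∈ Vertex × C ≐ Connected x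

  DistanceAtMost : ℕ → Rel V (v ⊔ k ⊔ e)
  DistanceAtMost d x y = ∃[ n ] n ≤ d × Walk n x y

  IsDistance : ℕ → Rel V (v ⊔ k ⊔ e)
  IsDistance d x y = Walk d x y × (∀ n → Walk n x y → d ≤ n)

  record HasDiameter (d : ℕ) : Set (v ⊔ k ⊔ c ⊔ e) where
    field
      bounded  : ∀ {x y} → x ∈ Vertex → y ∈ Vertex → DistanceAtMost d x y
      attained : ∃[ x ] ∃[ y ] x ∈ Vertex × y ∈ Vertex × IsDistance d x y

  -- Every edge of colour i occurs here once for each orientation, and
  -- SameEdge identifies the two.
  EdgesOfColour : Colour → Set (v ⊔ e)
  EdgesOfColour i = Σ (V × V) (uncurry (Edge i))

  SameEdge : ∀ i → Rel (EdgesOfColour i) v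
  SameEdge i ((x , y) , _) ((x′ , y′) , _) = (x ≡ x′ × y ≡ y′) ⊎ (x ≡ y′ × y ≡ x′)

induced : {V : Set v} {Colour : Set k} → ColouredMultigraph V Colour c e →
          Pred V ℓ → ColouredMultigraph V Colour (c ⊔ ℓ) (e ⊔ ℓ)
induced G C = record
  { Vertex   = λ x → x ∈ Vertex × x ∈ C
  ; Edge     = λ i x y → x ∈ C × y ∈ C × Edge i x y
  ; isVertex = λ { (x∈C , _ , xy) → isVertex xy , x∈C }
  ; symEdge  = λ { (x∈C , y∈C , xy) → y∈C , x∈C , symEdge xy }
  ; loopless = λ { (_ , _ , xy) → loopless xy }
  }
  where open ColouredMultigraph G

module _ (K : Kei a) where
  open Kei K

  -- Colours are elements of the kei; only those in S colour an edge.
  keiGraph : Pred Carrier s → ColouredMultigraph Carrier Carrier a (a ⊔ s)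
  keiGraph S = record
    { Vertex   = λ _ → ⊤
    ; Edge     = λ y u w → y ∈ S × u ≢ w × u ▷ y ≡ w
    ; isVertex = λ _ → _
    ; symEdge  = λ { {y} {u} (y∈S , u≢w , u▷y≡w) →
        y∈S , (λ w≡u → u≢w (sym w≡u)) , trans (cong (_▷ y) (sym u▷y≡w)) (involutive u y) }
    ; loopless = λ { (_ , u≢w , _) → u≢w }
    }

{-# OPTIONS --safe #-}
module Submission where

-- A walk of length d between vertices at distance d yields a product of d
-- involutions f_y carrying u to v.  Each of its 2^d subproducts is applied to u.
-- Since f_y f_z = f_z f_(y ▷ z), the factors left out can be moved to the end,
-- so the image of u under a subproduct with j factors lies within j steps of u
-- and within d ∸ j steps of v.  A coincidence between two images would then give
-- a shortcut from u to v, so the images are distinct; pairing those that differ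
-- only in the last factor gives 2^(d ∸ 1) edges of its colour.

open import Defs
open import Data.Fin.Base using (Fin)
open import Data.Fin.Properties using (*↔×; 2↔Bool)
open import Data.Fin.Subset using (Subset; ∣_∣; ∁; inside; outside)
open import Data.Fin.Subset.Properties using (∣∁p∣≡n∸∣p∣; ∣p∣≤n)
open import Data.Nat.Base using (ℕ; zero; suc; _+_; _≤_; _∸_; _^_; s≤s; s≤s⁻¹)
open import Data.Nat.Properties
  using (≤-refl; ≤-trans; ≤-total; m≤n⇒m≤1+n; +-monoʳ-≤; m∸n+n≡m; <-irrefl; _≤?_; module ≤-Reasoning)
open import Data.Product.Base using (∃-syntax; _×_; _,_; proj₁; proj₂; uncurry)
open import Data.Product.Function.NonDependent.Propositional using (_×-↔_)
open import Data.Sum.Base using (inj₁; inj₂)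
open import Data.Vec.Base using (_∷_; []; head; tail)
open import Function.Base using (_∘_)
open import Function.Bundles using (_↔_; mk↔ₛ′; module Injection)
open import Function.Construct.Composition using (_↔-∘_)
open import Function.Definitions using (Injective)
open import Function.Properties.Inverse using (↔⇒↣)
open import Level using (Level; _⊔_)
open import Relation.Binary.PropositionalEquality using (_≡_; _≢_; refl; sym; trans; cong; subst)
open import Relation.Nullary using (¬_; yes; no; contradiction)
open import Relation.Nullary.Decidable using (decidable-stable; ¬¬-excluded-middle)
open import Relation.Unary using (Pred; _∈_)

fin↔subset : ∀ n → Fin (2 ^ n) ↔ Subset n
fin↔subset zero    = mk↔ₛ′ (λ _ → []) (λ _ → Fin.zero) (λ { [] → refl }) (λ { Fin.zero → refl ; (Fin.suc ()) })
fin↔subset (suc n) = cons ↔-∘ ((2↔Bool ×-↔ fin↔subset n) ↔-∘ *↔×)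
  where
  cons = mk↔ₛ′ (uncurry _∷_) (λ p → head p , tail p) (λ { (_ ∷ _) → refl }) (λ _ → refl)

AtLeast-2^ : ∀ {a ℓ} {A : Set a} (_≈_ : A → A → Set ℓ) {n} (f : Subset n → A) →
             Injective _≡_ _≈_ f → AtLeast (2 ^ n) A _≈_
AtLeast-2^ _ {n} f f-injective =
  f ∘ Injection.to fin↣subset , Injection.injective fin↣subset ∘ f-injective
  where fin↣subset = ↔⇒↣ (fin↔subset n)

∣∁p∣+∣p∣≡n : ∀ {n} (p : Subset n) → ∣ ∁ p ∣ + ∣ p ∣ ≡ n
∣∁p∣+∣p∣≡n p = trans (cong (_+ ∣ p ∣) (∣∁p∣≡n∸∣p∣ p)) (m∸n+n≡m (∣p∣≤n p))

Walk-snoc : ∀ {v k c e} {V : Set v} {Colour : Set k} {G : ColouredMultigraph V Colour c e} {n x y z} →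
            Walk G n x y → Adjacent G y z → Walk G (suc n) x z
Walk-snoc stop           yz = step yz stop
Walk-snoc (step xx′ x′y) yz = step xx′ (Walk-snoc x′y yz)

module _ {a s} (K : Kei a) (S : Pred (Kei.Carrier K) s) where
  open Kei K

  ▷-cancelʳ : ∀ {x y} z → x ▷ z ≡ y ▷ z → x ≡ y
  ▷-cancelʳ z = proj₁ (bijective z)

  infix 4 _⟶[_]_
  infixl 5 _▷▷_

  -- Unlike in a walk, a step may fix the current point: whether it does is
  -- undecidable in general.
  data _⟶[_]_ (u : Carrier) : ℕ → Carrier → Set (a ⊔ s) where
    ε    : u ⟶[ 0 ] u
    _▷▷_ : ∀ {n v y} → u ⟶[ n ] v → y ∈ S → u ⟶[ suc n ] v ▷ y

  ⟶-trans : ∀ {m n u v w} → u ⟶[ m ] v → v ⟶[ n ] w → u ⟶[ n + m ] w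
  ⟶-trans p ε          = p
  ⟶-trans p (q ▷▷ y∈S) = ⟶-trans p q ▷▷ y∈S

  -- Competing paths may contain steps that fix their point, because the shortcuts built below may
  -- contain such steps.
  record Geodesic {n u v} (p : u ⟶[ n ] v) : Set (a ⊔ s) where
    constructor geodesic
    field minimal : ∀ {m} → u ⟶[ m ] v → n ≤ m

  open Geodesic

  geodesic-init : ∀ {n u v y} {p : u ⟶[ n ] v} {y∈S : y ∈ S} → Geodesic (p ▷▷ y∈S) → Geodesic p
  geodesic-init {y∈S = y∈S} geo = geodesic λ q → s≤s⁻¹ (minimal geo (q ▷▷ y∈S))

  -- The head of the subset decides about the last step of the path.
  subproduct : ∀ {n u v} → u ⟶[ n ] v → Subset n → Carrier
  subproduct {u = u} ε [] = u
  subproduct (p ▷▷ _) (outside ∷ A) = subproduct p A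
  subproduct (_▷▷_ {y = y} p _) (inside ∷ A) = subproduct p A ▷ y

  start⟶subproduct : ∀ {n u v} (p : u ⟶[ n ] v) (A : Subset n) → u ⟶[ ∣ A ∣ ] subproduct p A
  start⟶subproduct ε          []            = ε
  start⟶subproduct (p ▷▷ _)   (outside ∷ A) = start⟶subproduct p A
  start⟶subproduct (p ▷▷ y∈S) (inside  ∷ A) = start⟶subproduct p A ▷▷ y∈S

  module _ (closed : Closed K S) where

    -- `f_z` is an automorphism: it turns a step by `y` into a step by `y ▷ z`, so the length is
    -- kept.
    ⟶-translate : ∀ {n u v z} → z ∈ S → u ⟶[ n ] v → u ▷ z ⟶[ n ] v ▷ z
    ⟶-translate z∈S ε = ε
    ⟶-translate {u = u} {z = z} z∈S (_▷▷_ {v = v} {y = y} p y∈S) =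
      subst (u ▷ z ⟶[ _ ]_) (sym (selfDistribute z v y)) (⟶-translate z∈S p ▷▷ closed y∈S z∈S)

    -- Only omitted factors cost a step: an omitted last factor is appended, while a kept one moves
    -- both ends of the path found so far.
    subproduct⟶end : ∀ {n u v} (p : u ⟶[ n ] v) (A : Subset n) → subproduct p A ⟶[ ∣ ∁ A ∣ ] v
    subproduct⟶end ε          []            = ε
    subproduct⟶end (p ▷▷ y∈S) (outside ∷ A) = subproduct⟶end p A ▷▷ y∈S
    subproduct⟶end (p ▷▷ y∈S) (inside  ∷ A) = ⟶-translate y∈S (subproduct⟶end p A)

    no-shortcut : ∀ {n u v y} {p : u ⟶[ n ] v} {y∈S : y ∈ S} → Geodesic (p ▷▷ y∈S) →
                  (A B : Subset n) → ∣ B ∣ ≤ ∣ A ∣ → subproduct p A ▷ y ≢ subproduct p B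
    no-shortcut {n} {u} {v} {y} {p} {y∈S} geo A B ∣B∣≤∣A∣ eq = <-irrefl refl (begin-strict
      -- The shortcut runs from `u` through the common point to `v ▷ y`; strictness comes from
      -- `geo`, which concerns a path of length `suc n`.
      n                  <⟨ minimal geo (⟶-trans u⟶A▷y (⟶-translate y∈S (subproduct⟶end p A))) ⟩
      ∣ ∁ A ∣ + ∣ B ∣    ≤⟨ +-monoʳ-≤ (∣ ∁ A ∣) ∣B∣≤∣A∣ ⟩
      ∣ ∁ A ∣ + ∣ A ∣    ≡⟨ ∣∁p∣+∣p∣≡n A ⟩
      n                  ∎)
      where
      open ≤-Reasoning
      u⟶A▷y : u ⟶[ ∣ B ∣ ] subproduct p A ▷ y
      u⟶A▷y = subst (u ⟶[ _ ]_) (sym eq) (start⟶subproduct p B)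

    -- The relation between the two subproducts is symmetric, so the sizes may be assumed ordered.
    subproduct-▷-≢ : ∀ {n u v y} {p : u ⟶[ n ] v} {y∈S : y ∈ S} → Geodesic (p ▷▷ y∈S) →
                     (A B : Subset n) → subproduct p A ▷ y ≢ subproduct p B
    subproduct-▷-≢ {y = y} geo A B eq with ≤-total (∣ B ∣) (∣ A ∣)
    ... | inj₁ ∣B∣≤∣A∣ = no-shortcut geo A B ∣B∣≤∣A∣ eq
    ... | inj₂ ∣A∣≤∣B∣ = no-shortcut geo B A ∣A∣≤∣B∣ (trans (cong (_▷ y) (sym eq)) (involutive _ y))

    subproduct-injective : ∀ {n u v} (p : u ⟶[ n ] v) → Geodesic p → Injective _≡_ _≡_ (subproduct p)
    subproduct-injective ε _ {[]} {[]} _ = refl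
    subproduct-injective (p ▷▷ _) geo {outside ∷ A} {outside ∷ B} eq =
      cong (outside ∷_) (subproduct-injective p (geodesic-init geo) eq)
    subproduct-injective (p ▷▷ _) geo {outside ∷ A} {inside  ∷ B} eq =
      contradiction (sym eq) (subproduct-▷-≢ geo B A)
    subproduct-injective (p ▷▷ _) geo {inside  ∷ A} {outside ∷ B} eq =
      contradiction eq (subproduct-▷-≢ geo A B)
    subproduct-injective (p ▷▷ _) geo {inside  ∷ A} {inside  ∷ B} eq =
      cong (inside ∷_) (subproduct-injective p (geodesic-init geo) (▷-cancelʳ _ eq))

    module _ {c} {C : Pred Carrier c} (component : IsComponent (keiGraph K S) C) where

      private
        G[C] = induced (keiGraph K S) C

      component-closed : ∀ {x y} → x ∈ C → y ∈ S → x ≢ x ▷ y → (x ▷ y) ∈ C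
      component-closed x∈C y∈S x≢x▷y =
        let _ , _ , C⊆Connected , Connected⊆C = component in
        Connected⊆C (_ , Walk-snoc (proj₂ (C⊆Connected x∈C)) (_ , y∈S , x≢x▷y , refl))

      subproduct-∈ : ∀ {n u v} (p : u ⟶[ n ] v) → Geodesic p → u ∈ C → ∀ A → subproduct p A ∈ C
      subproduct-∈ ε          _   u∈C []            = u∈C
      subproduct-∈ (p ▷▷ _)   geo u∈C (outside ∷ A) = subproduct-∈ p (geodesic-init geo) u∈C A
      subproduct-∈ (p ▷▷ y∈S) geo u∈C (inside  ∷ A) =
        -- Taking `A` twice shows that the kept factor moves its point, so this step is an edge and
        -- stays in the component.
        component-closed (subproduct-∈ p (geodesic-init geo) u∈C A) y∈S (subproduct-▷-≢ geo A A ∘ sym)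

      -- Walks grow at the front and paths at the end, so the path runs backwards, each edge being
      -- reversed by involutivity.
      Walk⇒⟶ : ∀ {n x y} → Walk G[C] n x y → y ⟶[ n ] x
      Walk⇒⟶ stop = ε
      Walk⇒⟶ (step {x = x} (k , _ , _ , k∈S , _ , x▷k≡z) w) =
        subst (_ ⟶[ _ ]_) (trans (cong (_▷ k) (sym x▷k≡z)) (involutive x k)) (Walk⇒⟶ w ▷▷ k∈S)

      -- Dropping the steps that fix their point leaves a walk, possibly shorter; the case split on
      -- which steps do so is available only under double negation.
      ⟶⇒¬¬Walk : ∀ {n u v} → u ∈ C → u ⟶[ n ] v → ¬ ¬ (v ∈ C × DistanceAtMost G[C] n v u)
      ⟶⇒¬¬Walk u∈C ε ¬w = ¬w (u∈C , 0 , ≤-refl , stop)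
      ⟶⇒¬¬Walk u∈C (_▷▷_ {v = v} {y = y} p y∈S) ¬w =
        ⟶⇒¬¬Walk u∈C p λ (v∈C , m , m≤n , w) → ¬¬-excluded-middle λ where
          (yes v≡v▷y) → ¬w (subst (λ x → x ∈ C × DistanceAtMost G[C] _ x _) v≡v▷y
                              (v∈C , m , m≤n⇒m≤1+n m≤n , w))
          (no v≢v▷y)  → let v▷y∈C = component-closed v∈C y∈S v≢v▷y in
            ¬w (v▷y∈C , suc m , s≤s m≤n ,
                step (y , v▷y∈C , v∈C , y∈S , v≢v▷y ∘ sym , involutive v y) w)

      IsDistance⇒Geodesic : ∀ {n u v} → u ∈ C → (dist : IsDistance G[C] n v u) → Geodesic (Walk⇒⟶ (proj₁ dist))
      IsDistance⇒Geodesic u∈C (_ , n≤length) = geodesic λ p →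
        -- The goal is a decidable inequality, so a walk known only up to double negation suffices.
        decidable-stable (_ ≤? _) λ n≰m →
          ⟶⇒¬¬Walk u∈C p λ (_ , l , l≤m , w) → n≰m (≤-trans (n≤length l w) l≤m)

      geodesic-vertices : ∀ {n u v} (p : u ⟶[ n ] v) → Geodesic p → u ∈ C →
                          AtLeast (2 ^ n) (Elements C) (SamePoint C)
      geodesic-vertices p geo u∈C =
        AtLeast-2^ (SamePoint C) (λ A → subproduct p A , subproduct-∈ p geo u∈C A) (subproduct-injective p geo)

      -- The colour is the last factor, which exists by `1 ≤ n`; each subset of the other factors
      -- gives one edge.
      geodesic-edges : ∀ {n u v} (p : u ⟶[ n ] v) → Geodesic p → u ∈ C → 1 ≤ n →
                       ∃[ k ] k ∈ S × AtLeast (2 ^ (n ∸ 1)) (EdgesOfColour G[C] k) (SameEdge G[C] k)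
      geodesic-edges (_▷▷_ {y = y} p y∈S) geo u∈C _ = y , y∈S , AtLeast-2^ (SameEdge G[C] y) edge λ where
          (inj₁ (eq , _)) → subproduct-injective p (geodesic-init geo) eq
          -- Opposite orientations would make one subproduct the image of the other under the last
          -- factor.
          (inj₂ (eq , _)) → contradiction (sym eq) (subproduct-▷-≢ geo _ _)
        where
        edge : Subset _ → EdgesOfColour G[C] y
        edge A = (subproduct p A , subproduct p A ▷ y)
               , subproduct-∈ p (geodesic-init geo) u∈C A
               , subproduct-∈ (p ▷▷ y∈S) geo u∈C (inside ∷ A)
               , y∈S , subproduct-▷-≢ geo A A ∘ sym , refl

theorem1p4 : ∀ {a s c : Level} (K : Kei a) →
    (S : Pred (Kei.Carrier K) s) → IsSubkei K S →
    (C : Pred (Kei.Carrier K) c) → IsComponent (keiGraph K S) C →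
    (d : ℕ) → HasDiameter (induced (keiGraph K S) C) d →
    AtLeast (2 ^ d) (Elements C) (SamePoint C) ×
    (1 ≤ d → ∃[ k ] k ∈ S × AtLeast (2 ^ (d ∸ 1)) (EdgesOfColour (induced (keiGraph K S) C) k) (SameEdge (induced (keiGraph K S) C) k))
theorem1p4 K S subkei C component d diameter with HasDiameter.attained diameter
... | x , u , _ , (_ , u∈C) , dist =
  geodesic-vertices K S closed component p geo u∈C , geodesic-edges K S closed component p geo u∈C
  where
  open IsSubkei subkei using (closed)
  p   = Walk⇒⟶ K S closed component (proj₁ dist)
  geo : Geodesic K S p
  geo = IsDistance⇒Geodesic K S closed component u∈C dist
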